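{- Let $P$ be an upper semilattice (a poset in which any two elements have a join) and let $\to$ be a total binary operation on $P$. Then $(P,\to)$ is a j-extended SP-nearlattice if and only if, for all $x,y,z\in P$, (1) the meet $(x\to y)\wedge(x\vee y)$ exists and $(x\to y)\wedge(x\vee y)=y$; (2) the meet $(z\vee y)\wedge(x\vee y)$ exists and $z\le x\to\bigl((z\vee y)\wedge(x\vee y)\bigr)$.
   Context: A nearlattice is an upper semilattice in which every pair of elements that has a common lower bound has a greatest lower bound. For a poset $P$ and $y\in P$ put $[y)=\{u\in P: y\le u\}$. For $y\le x$, the pseudocomplement $x*y$ of $x$ in $[y)$ is the greatest $u\in[y)$ such that $y$ is the only common lower bound of $u$ and $x$ belonging to $[y)$. $P$ is sectionally pseudocomplemented if $x*y$ exists whenever $y\le x$. $(P,\to)$ is a j-extended SP-nearlattice if $P$ is a nearlattice which is sectionally pseudocomplemented and $x\to y=(x\vee y)*y$ for all $x,y\in P$. -}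

module Defs where

open import Algebra.Core using (Op₂)
open import Data.Product using (∃; _×_; proj₁)
open import Level using (Level; _⊔_)
open import Relation.Binary.Lattice using (JoinSemilattice)
open import Relation.Unary using (Pred)

module _ {c ℓ₁ ℓ₂ : Level} (P : JoinSemilattice c ℓ₁ ℓ₂) where
  open JoinSemilattice P

  IsGreatest : {ℓ : Level} → Pred Carrier ℓ → Carrier → Set (c ⊔ ℓ₂ ⊔ ℓ)
  IsGreatest Q g = Q g × (∀ u → Q u → u ≤ g)

  CommonLowerBound : Carrier → Carrier → Pred Carrier ℓ₂
  CommonLowerBound x y w = w ≤ x × w ≤ y

  -- A proof of IsMeet x y m says that x ∧ y exists and equals m.
  IsMeet : Carrier → Carrier → Carrier → Set (c ⊔ ℓ₂)
  IsMeet x y = IsGreatest (CommonLowerBound x y)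

  IsNearlattice : Set (c ⊔ ℓ₂)
  IsNearlattice = ∀ x y → ∃ (CommonLowerBound x y) → ∃ (IsMeet x y)

  Section : Carrier → Pred Carrier ℓ₂
  Section y u = y ≤ u

  OnlyCommonLowerBoundInSection :
    Carrier → Carrier → Carrier → Set (c ⊔ ℓ₁ ⊔ ℓ₂)
  OnlyCommonLowerBoundInSection y u x =
    CommonLowerBound u x y ×
    (∀ w → Section y w → CommonLowerBound u x w → w ≈ y)

  -- IsPseudocomplement x y p : p is the pseudocomplement x * y of x in [ y ).
  -- It is only meant to be used for y ≤ x.
  IsPseudocomplement : Carrier → Carrier → Carrier → Set (c ⊔ ℓ₁ ⊔ ℓ₂)
  IsPseudocomplement x y =
    IsGreatest (λ u → Section y u × OnlyCommonLowerBoundInSection y u x)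

  SectionallyPseudocomplemented : Set (c ⊔ ℓ₁ ⊔ ℓ₂)
  SectionallyPseudocomplemented =
    ∀ x y → y ≤ x → ∃ (IsPseudocomplement x y)

  record IsJExtendedSPNearlattice (_⇒_ : Op₂ Carrier)
         : Set (c ⊔ ℓ₁ ⊔ ℓ₂) where
    field
      isNearlattice                 : IsNearlattice
      sectionallyPseudocomplemented : SectionallyPseudocomplemented

    pseudocomplement : ∀ x y → y ≤ x → Carrier
    pseudocomplement x y y≤x = proj₁ (sectionallyPseudocomplemented x y y≤x)

    field
      ⇒-def : ∀ x y → (x ⇒ y) ≈ pseudocomplement (x ∨ y) y (y≤x∨y x y)

{-# OPTIONS --safe #-}
module Submission where

open import Algebra.Core using (Op₂)
open import Algebra.Definitions using (Congruent₂)
open import Data.Product using (_×_; _,_; ∃-syntax; proj₁; proj₂)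
open import Function.Bundles using (_⇔_; mk⇔)
open import Level using (Level)
open import Relation.Binary.Lattice using (JoinSemilattice)
open import Relation.Unary using (Pred)
open import Defs

-- Condition (1) says that `x ⇒ y` is a candidate for the pseudocomplement of `x ∨ y` in `[y)`;
-- condition (2) supplies the meets and makes that candidate the greatest one. Conversely, in a
-- j-extended SP-nearlattice both meets exist because `y` is a common lower bound. The first equals
-- `y` by the definition of the pseudocomplement. If `m` is the second, then `z ∨ y` is a candidate
-- in `[m)`, hence lies below `x ⇒ m`.

module _ {c ℓ₁ ℓ₂ : Level} (P : JoinSemilattice c ℓ₁ ℓ₂) where
  open JoinSemilattice P

  greatest-unique : {ℓ : Level} {Q : Pred Carrier ℓ} {g h : Carrier} →
                    IsGreatest P Q g → IsGreatest P Q h → g ≈ h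
  greatest-unique (Qg , g-max) (Qh , h-max) = antisym (h-max _ Qg) (g-max _ Qh)

  y≤x⇒x∨y≤x : ∀ {x y} → y ≤ x → x ∨ y ≤ x
  y≤x⇒x∨y≤x y≤x = ∨-least refl y≤x

  -- Equality is passed as two inequalities, the form in which absorption of `y` in `x ∨ y` is
  -- obtained when `y ≤ x`.
  meet-cong : ∀ {x x′ y y′ m} → x ≤ x′ → x′ ≤ x → y ≤ y′ → y′ ≤ y →
                   IsMeet P x y m → IsMeet P x′ y′ m
  meet-cong x≤x′ x′≤x y≤y′ y′≤y ((m≤x , m≤y) , m-max) =
    (trans m≤x x≤x′ , trans m≤y y≤y′) ,
    λ u (u≤x′ , u≤y′) → m-max u (trans u≤x′ x′≤x , trans u≤y′ y′≤y)

  onlyCommonLowerBound-cong : ∀ {x x′ y u} → x ≤ x′ → x′ ≤ x →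
                              OnlyCommonLowerBoundInSection P y u x →
                              OnlyCommonLowerBoundInSection P y u x′
  onlyCommonLowerBound-cong x≤x′ x′≤x ((y≤u , y≤x) , only) =
    (y≤u , trans y≤x x≤x′) ,
    λ w y≤w (w≤u , w≤x′) → only w y≤w (w≤u , trans w≤x′ x′≤x)

  pseudocomplement-cong : ∀ {x x′ y p} → x ≤ x′ → x′ ≤ x →
                          IsPseudocomplement P x y p →
                          IsPseudocomplement P x′ y p
  pseudocomplement-cong x≤x′ x′≤x ((y≤p , only) , p-max) =
    (y≤p , onlyCommonLowerBound-cong x≤x′ x′≤x only) ,
    λ u (y≤u , only′) →
      p-max u (y≤u , onlyCommonLowerBound-cong x′≤x x≤x′ only′)

  module _ {_⇒_ : Op₂ Carrier} (J : IsJExtendedSPNearlattice P _⇒_) where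
    open IsJExtendedSPNearlattice J

    private
      pc : ∀ x y → IsPseudocomplement P (x ∨ y) y
                     (pseudocomplement (x ∨ y) y (y≤x∨y x y))
      pc x y = proj₂ (sectionallyPseudocomplemented (x ∨ y) y (y≤x∨y x y))

      ⇒≤pc : ∀ x y → (x ⇒ y) ≤ pseudocomplement (x ∨ y) y (y≤x∨y x y)
      ⇒≤pc x y = reflexive (⇒-def x y)

      pc≤⇒ : ∀ x y → pseudocomplement (x ∨ y) y (y≤x∨y x y) ≤ (x ⇒ y)
      pc≤⇒ x y = reflexive (Eq.sym (⇒-def x y))

    ⇒∧∨-meet : ∀ x y → ∃[ m ] (IsMeet P (x ⇒ y) (x ∨ y) m × m ≈ y)
    ⇒∧∨-meet x y with pc x y
    ... | (y≤p , _ , only) , _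
      with isNearlattice (x ⇒ y) (x ∨ y)
             (y , trans y≤p (pc≤⇒ x y) , y≤x∨y x y)
    ... | m , meet@((m≤x⇒y , m≤x∨y) , m-max) =
      m , meet ,
      only m (m-max y (trans y≤p (pc≤⇒ x y) , y≤x∨y x y))
             (trans m≤x⇒y (⇒≤pc x y) , m≤x∨y)

    -- Since `m ≤ x ∨ y`, also `x ∨ m ≤ x ∨ y`. So a common lower bound of `z ∨ y` and `x ∨ m` is
    -- below `m`, and `z ∨ y` competes for the pseudocomplement of `x ∨ m` in `[m)`.
    ∨∧∨-meet : ∀ x y z →
               ∃[ m ] (IsMeet P (z ∨ y) (x ∨ y) m × z ≤ (x ⇒ m))
    ∨∧∨-meet x y z
      with isNearlattice (z ∨ y) (x ∨ y) (y , y≤x∨y z y , y≤x∨y x y)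
    ... | m , meet@((m≤z∨y , m≤x∨y) , m-max) =
      m , meet ,
      trans (x≤x∨y z y)
            (trans (proj₂ (pc x m) (z ∨ y)
                     (m≤z∨y , (m≤z∨y , y≤x∨y x m) , only))
                   (pc≤⇒ x m))
      where
      only : ∀ w → m ≤ w → CommonLowerBound P (z ∨ y) (x ∨ m) w → w ≈ m
      only w m≤w (w≤z∨y , w≤x∨m) =
        antisym (m-max w (w≤z∨y , trans w≤x∨m (∨-least (x≤x∨y x y) m≤x∨y))) m≤w

  module _ {_⇒_ : Op₂ Carrier} (⇒-cong : Congruent₂ _≈_ _⇒_)
           (⇒∧∨ : ∀ x y → ∃[ m ] (IsMeet P (x ⇒ y) (x ∨ y) m × m ≈ y))
           (∨∧∨ : ∀ x y z →
                  ∃[ m ] (IsMeet P (z ∨ y) (x ∨ y) m × z ≤ (x ⇒ m))) where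

    -- A common lower bound `b` is absorbed by `x` and `y`, so the meet of `x ∨ b` and `y ∨ b` given
    -- by (2) is a meet of `x` and `y`.
    nearlattice : IsNearlattice P
    nearlattice x y (b , b≤x , b≤y) with ∨∧∨ y b x
    ... | m , meet , _ =
      m , meet-cong (y≤x⇒x∨y≤x b≤x) (x≤x∨y x b)
                         (y≤x⇒x∨y≤x b≤y) (x≤x∨y y b) meet

    ⇒-isPseudocomplement : ∀ x y → IsPseudocomplement P (x ∨ y) y (x ⇒ y)
    ⇒-isPseudocomplement x y with ⇒∧∨ x y
    ... | n , ((n≤x⇒y , _) , n-max) , n≈y =
      (y≤x⇒y , (y≤x⇒y , y≤x∨y x y) ,
        λ w y≤w clb → antisym (trans (n-max w clb) (reflexive n≈y)) y≤w) ,
      greatest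
      where
      y≤x⇒y : y ≤ (x ⇒ y)
      y≤x⇒y = trans (reflexive (Eq.sym n≈y)) n≤x⇒y

      greatest : ∀ u → y ≤ u × OnlyCommonLowerBoundInSection P y u (x ∨ y) →
                 u ≤ (x ⇒ y)
      -- Condition (2) with `z` the competitor `u`: its meet `m` collapses to `y`, so `u ≤ x ⇒ m`
      -- becomes `u ≤ x ⇒ y`.
      greatest u (y≤u , _ , only) with ∨∧∨ x y u
      ... | m , ((m≤u∨y , m≤x∨y) , m-max) , u≤x⇒m =
        trans u≤x⇒m (reflexive (⇒-cong Eq.refl m≈y))
        where
        m≈y : m ≈ y
        -- As `u ∨ y ≤ u`, `m` is a common lower bound of `u` and `x ∨ y` in `[y)`.
        m≈y = only m (m-max y (y≤x∨y u y , y≤x∨y x y))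
                     (trans m≤u∨y (y≤x⇒x∨y≤x y≤u) , m≤x∨y)

    isJExtendedSPNearlattice : IsJExtendedSPNearlattice P _⇒_
    isJExtendedSPNearlattice = record
      { isNearlattice                 = nearlattice
      ; sectionallyPseudocomplemented = sp
      -- The pseudocomplement chosen by `sp` is `(x ∨ y) ⇒ y`; uniqueness identifies it with
      -- `x ⇒ y`.
      ; ⇒-def = λ x y → greatest-unique (⇒-isPseudocomplement x y)
                          (proj₂ (sp (x ∨ y) y (y≤x∨y x y)))
      }
      where
      sp : SectionallyPseudocomplemented P
      sp x y y≤x = (x ⇒ y) , pseudocomplement-cong (y≤x⇒x∨y≤x y≤x) (x≤x∨y x y)
                             (⇒-isPseudocomplement x y)

theorem6p17 : {c ℓ₁ ℓ₂ : Level} (P : JoinSemilattice c ℓ₁ ℓ₂) →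
    let open JoinSemilattice P in
    (_⇒_ : Op₂ Carrier) → Congruent₂ _≈_ _⇒_ →
    IsJExtendedSPNearlattice P _⇒_ ⇔
    (∀ x y z →
    (∃[ m ] (IsMeet P (x ⇒ y) (x ∨ y) m × m ≈ y)) ×
    (∃[ m ] (IsMeet P (z ∨ y) (x ∨ y) m × z ≤ (x ⇒ m))))
theorem6p17 P _⇒_ ⇒-cong = mk⇔
  (λ J x y z → ⇒∧∨-meet P J x y , ∨∧∨-meet P J x y z)
  (λ h → isJExtendedSPNearlattice P ⇒-cong
           -- Condition (1) does not mention `z`, so any value serves; `y` is at hand.
           (λ x y → proj₁ (h x y y)) (λ x y z → proj₂ (h x y z)))
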